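{- There exists a constant $c$ such that every $(4K_1, C_4, C_6)$-free graph $G$ that contains a $C_7$ as an induced subgraph has clique width $cwd(G) \le c$.
   Context: Graphs are finite, simple and undirected. For a set $L$ of graphs, a graph is $L$-free if it contains no graph of $L$ as an induced subgraph. $C_k$ denotes the chordless cycle on $k$ vertices, and $4K_1$ denotes the graph with four vertices and no edges. The clique width $cwd(G)$ of a graph $G$ is the minimum number of labels needed to build $G$ using the following four operations: (i) create a vertex labeled by an integer $\ell$; (ii) disjoint union of two labeled graphs; (iii) for labels $i \neq j$, add all edges between the vertices of label $i$ and the vertices of label $j$; (iv) relabel all vertices of label $i$ by label $j$. A class of graphs has bounded clique width if there is a constant bounding the clique width of all graphs in the class. -}

module Defs where

open import Data.Bool using (Bool; true; false; _∧_; _∨_; if_then_else_)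
import Data.Bool.Properties as Bool
open import Data.Bool.Properties using (∧-comm; ∨-comm)
open import Data.Empty using (⊥; ⊥-elim)
open import Data.Fin using
  ( Fin; zero; suc; toℕ; _↑ˡ_; _↑ʳ_; splitAt; combine; remQuot
  ; finToFun; funToFin; _≟_)
import Data.Fin as Fin
open import Data.Fin.Properties using
  ( any?; all?; splitAt-↑ˡ; splitAt-↑ʳ; splitAt⁻¹-↑ˡ; splitAt⁻¹-↑ʳ
  ; join-splitAt; ↑ˡ-injective; ↑ʳ-injective; remQuot-combine
  ; finToFun-funToFin)
open import Data.Fin.Subset using (Subset; _∈_; _⊃_; _∪_; ⁅_⁆)
  renaming (⊥ to ∅)
open import Data.Fin.Subset.Induction using (⊃-wellFounded)
open import Data.Fin.Subset.Properties using
  (_∈?_; x∈p∪q⁻; p⊆p∪q; q⊆p∪q; x∈⁅x⁆; x∈⁅y⁆⇒x≡y; ∉⊥)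
open import Data.List using (List)
open import Data.List.Relation.Unary.All using (All)
open import Data.Nat using
  (ℕ; zero; suc; _+_; _*_; _^_; _≤_; _<_; _≡ᵇ_; ∣_-_∣; _≤?_)
import Data.Nat.Properties as ℕ
open import Data.Nat.Properties using (∣-∣-comm; ∣n-n∣≡0)
open import Data.Product using
  (Σ-syntax; ∃; ∃-syntax; _×_; _,_; proj₁; proj₂)
open import Data.Sum using (_⊎_; inj₁; inj₂; [_,_])
open import Function using
  (Injective; _∘_; _↔_; mk↔ₛ′; module Inverse; module Injection)
open import Function.Properties.Inverse using (Inverse⇒Injection)
open import Induction.WellFounded using (Acc; acc)
open import Relation.Binary.PropositionalEquality
  using (_≡_; _≢_; refl; sym; trans; cong; cong₂; subst)
open import Relation.Nullary using
  (¬_; Dec; yes; no; does; ¬?; _×-dec_; _⊎-dec_; _→-dec_)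
open import Relation.Nullary.Decidable using
  (True; map′; decidable-stable)

record Graph : Set where
  field
    order      : ℕ
    adj        : Fin order → Fin order → Bool
    adj-sym    : ∀ u v → adj u v ≡ adj v u
    adj-irrefl : ∀ v → adj v v ≡ false

  Vertex : Set
  Vertex = Fin order

open Graph public

infix 4 _⊑_ _≅_

-- H is (isomorphic to) an induced subgraph of G.
_⊑_ : Graph → Graph → Set
H ⊑ G = Σ[ f ∈ (Vertex H → Vertex G) ]
          Injective _≡_ _≡_ f × (∀ u v → adj G (f u) (f v) ≡ adj H u v)

_≅_ : Graph → Graph → Set
G ≅ H = Σ[ f ∈ (Vertex G ↔ Vertex H) ]
          (∀ u v → adj H (Inverse.to f u) (Inverse.to f v) ≡ adj G u v)

_-free_ : List Graph → Graph → Set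
L -free G = All (λ H → ¬ (H ⊑ G)) L

edgeless : ℕ → Graph
edgeless n = record
  { order      = n
  ; adj        = λ _ _ → false
  ; adj-sym    = λ _ _ → refl
  ; adj-irrefl = λ _ → refl
  }

4K₁ : Graph
4K₁ = edgeless 4

-- Vertices 0, …, k-1 in cyclic order: i and j are adjacent iff |i - j| is 1
-- or k - 1.
C : (k : ℕ) {3≤k : True (3 ≤? k)} → Graph
C k@(suc (suc (suc _))) = record
  { order      = k
  ; adj        = λ i j → near ∣ toℕ i - toℕ j ∣
  ; adj-sym    = λ i j → cong near (∣-∣-comm (toℕ i) (toℕ j))
  ; adj-irrefl = λ i → cong near (∣n-n∣≡0 (toℕ i))
  }
  where
  near : ℕ → Bool
  near d = (d ≡ᵇ 1) ∨ (suc d ≡ᵇ k)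

record LabeledGraph (k : ℕ) : Set where
  field
    graph : Graph
    label : Vertex graph → Fin k

open LabeledGraph public

module _ {k : ℕ} where

  singleton : Fin k → LabeledGraph k
  singleton ℓ = record { graph = edgeless 1 ; label = λ _ → ℓ }

  disjointUnion : LabeledGraph k → LabeledGraph k → LabeledGraph k
  disjointUnion A B = record
    { graph = record
      { order      = order GA + order GB
      ; adj        = λ u v → adj⊎ (splitAt (order GA) u) (splitAt (order GA) v)
      ; adj-sym    = λ u v → sym⊎ (splitAt (order GA) u) (splitAt (order GA) v)
      ; adj-irrefl = λ v → irrefl⊎ (splitAt (order GA) v)
      }
    ; label = λ v → label⊎ (splitAt (order GA) v)
    }
    where
    GA = graph A
    GB = graph B

    adj⊎ : Vertex GA ⊎ Vertex GB → Vertex GA ⊎ Vertex GB → Bool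
    adj⊎ (inj₁ u) (inj₁ v) = adj GA u v
    adj⊎ (inj₂ u) (inj₂ v) = adj GB u v
    adj⊎ (inj₁ _) (inj₂ _) = false
    adj⊎ (inj₂ _) (inj₁ _) = false

    sym⊎ : ∀ u v → adj⊎ u v ≡ adj⊎ v u
    sym⊎ (inj₁ u) (inj₁ v) = adj-sym GA u v
    sym⊎ (inj₂ u) (inj₂ v) = adj-sym GB u v
    sym⊎ (inj₁ _) (inj₂ _) = refl
    sym⊎ (inj₂ _) (inj₁ _) = refl

    irrefl⊎ : ∀ v → adj⊎ v v ≡ false
    irrefl⊎ (inj₁ v) = adj-irrefl GA v
    irrefl⊎ (inj₂ v) = adj-irrefl GB v

    label⊎ : Vertex GA ⊎ Vertex GB → Fin k
    label⊎ (inj₁ v) = label A v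
    label⊎ (inj₂ v) = label B v

  addEdges : (i j : Fin k) → i ≢ j → LabeledGraph k → LabeledGraph k
  addEdges i j i≢j A = record
    { graph = record
      { order      = order G
      ; adj        = λ u v → adj G u v ∨ between (label A u) (label A v)
      ; adj-sym    = λ u v → cong₂ _∨_ (adj-sym G u v)
                                       (between-sym (label A u) (label A v))
      ; adj-irrefl = λ v → cong₂ _∨_ (adj-irrefl G v) (between-irrefl (label A v))
      }
    ; label = label A
    }
    where
    G = graph A

    between : Fin k → Fin k → Bool
    between a b = (does (a ≟ i) ∧ does (b ≟ j)) ∨ (does (a ≟ j) ∧ does (b ≟ i))

    between-sym : ∀ a b → between a b ≡ between b a
    between-sym a b = trans
      (∨-comm (does (a ≟ i) ∧ does (b ≟ j)) (does (a ≟ j) ∧ does (b ≟ i)))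
      (cong₂ _∨_ (∧-comm (does (a ≟ j)) (does (b ≟ i)))
                 (∧-comm (does (a ≟ i)) (does (b ≟ j))))

    between-irrefl : ∀ a → between a a ≡ false
    between-irrefl a with a ≟ i | a ≟ j
    ... | yes a≡i | yes a≡j = ⊥-elim (i≢j (trans (sym a≡i) a≡j))
    ... | yes _   | no _    = refl
    ... | no _    | yes _   = refl
    ... | no _    | no _    = refl

  relabelAll : (i j : Fin k) → LabeledGraph k → LabeledGraph k
  relabelAll i j A = record
    { graph = graph A
    ; label = λ v → if does (label A v ≟ i) then j else label A v
    }

data Expr (k : ℕ) : Set where
  vertex  : Fin k → Expr k
  _⊕_     : Expr k → Expr k → Expr k
  join    : (i j : Fin k) → i ≢ j → Expr k → Expr k
  relabel : (i j : Fin k) → Expr k → Expr k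

⟦_⟧ : ∀ {k} → Expr k → LabeledGraph k
⟦ vertex ℓ ⟧       = singleton ℓ
⟦ e₁ ⊕ e₂ ⟧        = disjointUnion ⟦ e₁ ⟧ ⟦ e₂ ⟧
⟦ join i j i≢j e ⟧ = addEdges i j i≢j ⟦ e ⟧
⟦ relabel i j e ⟧  = relabelAll i j ⟦ e ⟧

BuildableWith : ℕ → Graph → Set
BuildableWith k G = ∃[ e ] graph (⟦_⟧ {k} e) ≅ G

-- cwd(G) = k.  A relation rather than a function, since the graph with no
-- vertices is not built by any expression.
IsCliqueWidth : Graph → ℕ → Set
IsCliqueWidth G k = BuildableWith k G × (∀ j → BuildableWith j G → k ≤ j)

-- A graph built with c labels has a clique width.  Constructively this needs
-- BuildableWith k G to be decidable: the partially labelled graphs on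
-- Fin n (n the order of G) realised by some expression are the closure of
-- a finite type under decidable rules.

private

  closure : ∀ {N} (D : Fin N → Set) (Step : Subset N → Fin N → Set) →
    (∀ p s → Dec (Step p s)) →
    (∀ p s → (∀ {a} → a ∈ p → D a) → Step p s → D s) →
    Σ[ p ∈ Subset N ] ((∀ {a} → a ∈ p → D a) × (∀ s → Step p s → s ∈ p))
  closure {N} D Step step? sound = go ∅ (⊃-wellFounded ∅) (λ a∈ → ⊥-elim (∉⊥ a∈))
    where
    go : ∀ p → Acc _⊃_ p → (∀ {a} → a ∈ p → D a) →
         Σ[ p ∈ Subset N ] ((∀ {a} → a ∈ p → D a) × (∀ s → Step p s → s ∈ p))
    go p (acc rec) pD with any? (λ s → ¬? (s ∈? p) ×-dec step? p s)
    ... | no none = p , pD , λ s st → decidable-stable (s ∈? p) (λ s∉p → none (s , s∉p , st))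
    ... | yes (s , s∉p , st) = go (p ∪ ⁅ s ⁆)
      (rec ((p⊆p∪q ⁅ s ⁆) , s , q⊆p∪q p ⁅ s ⁆ (x∈⁅x⁆ s) , s∉p))
      λ a∈ → [ pD , (λ a∈s → subst D (sym (x∈⁅y⁆⇒x≡y s a∈s)) (sound p s pD st)) ] (x∈p∪q⁻ p ⁅ s ⁆ a∈)

  module _ (k n : ℕ) where

    -- A code gives each vertex a label, 0 meaning that the vertex is absent,
    -- and a row of adjacency bits.
    N : ℕ
    N = (suc k * 2 ^ n) ^ n

    bit : Bool → Fin 2
    bit false = zero
    bit true = suc zero
    unbit : Fin 2 → Bool
    unbit zero = false
    unbit (suc _) = true
    unbit-bit : ∀ b → unbit (bit b) ≡ b
    unbit-bit false = refl
    unbit-bit true = refl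

    abstract
      lab : Fin N → Fin n → Fin (suc k)
      lab s x = proj₁ (remQuot {suc k} (2 ^ n) (finToFun s x))

      edg : Fin N → Fin n → Fin n → Bool
      edg s x y = unbit (finToFun (proj₂ (remQuot {suc k} (2 ^ n) (finToFun s x))) y)

      mk : (Fin n → Fin (suc k)) → (Fin n → Fin n → Bool) → Fin N
      mk l e = funToFin (λ x → combine (l x) (funToFin (bit ∘ e x)))

      lab-mk : ∀ l e x → lab (mk l e) x ≡ l x
      lab-mk l e x = trans (cong (proj₁ ∘ remQuot {suc k} (2 ^ n)) (finToFun-funToFin _ x))
        (cong proj₁ (remQuot-combine {suc k} {2 ^ n} (l x) (funToFin (bit ∘ e x))))

      edg-mk : ∀ l e x y → edg (mk l e) x y ≡ e x y
      edg-mk l e x y = trans (cong unbit (trans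
         (cong (λ z → finToFun z y) (trans (cong (proj₂ ∘ remQuot {suc k} (2 ^ n)) (finToFun-funToFin _ x))
           (cong proj₂ (remQuot-combine {suc k} {2 ^ n} (l x) (funToFin (bit ∘ e x))))))
         (finToFun-funToFin _ y))) (unbit-bit _)

    -- Edges of s at absent vertices are irrelevant.
    record Realizes (A : LabeledGraph k) (φ : Vertex (graph A) → Fin n) (s : Fin N) : Set where
      field
        inj   : ∀ {u v} → φ u ≡ φ v → u ≡ v
        labφ  : ∀ u → lab s (φ u) ≡ suc (label A u)
        adjφ  : ∀ u v → edg s (φ u) (φ v) ≡ adj (graph A) u v
        cover : ∀ x → lab s x ≢ zero → ∃[ u ] φ u ≡ x
    open Realizes

    nz : ∀ {A φ s} (R : Realizes A φ s) u → lab s (φ u) ≢ zero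
    nz R u eq with trans (sym (labφ R u)) eq
    ... | ()

    uncov : ∀ {A φ s} (R : Realizes A φ s) x → (∀ u → φ u ≢ x) → lab s x ≡ zero
    uncov {s = s} R x h = decidable-stable (lab s x ≟ zero)
      (λ ne → h _ (proj₂ (cover R x ne)))

    canon : ∀ A (φ : Vertex (graph A) → Fin n) → (∀ {u v} → φ u ≡ φ v → u ≡ v) → ∃ (Realizes A φ)
    canon A φ inj = mk l e , record
      { inj = inj
      ; labφ = λ u → trans (lab-mk l e _) (l1 u (pre? (φ u)))
      ; adjφ = λ u v → trans (edg-mk l e _ _) (e1 u v (pre? (φ u)) (pre? (φ v)))
      ; cover = λ x ne → l2 (pre? x) (λ eq → ne (trans (lab-mk l e x) eq))
      }
      where
      Pre : Fin n → Set
      Pre x = ∃[ u ] φ u ≡ x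
      pre? : ∀ x → Dec (Pre x)
      pre? x = any? (λ u → φ u ≟ x)
      l′ : ∀ {x} → Dec (Pre x) → Fin (suc k)
      l′ (yes (u , _)) = suc (label A u)
      l′ (no _) = zero
      e′ : ∀ {x y} → Dec (Pre x) → Dec (Pre y) → Bool
      e′ (yes (u , _)) (yes (v , _)) = adj (graph A) u v
      e′ _ _ = false
      l = λ x → l′ (pre? x)
      e = λ x y → e′ (pre? x) (pre? y)
      l1 : ∀ u (d : Dec (Pre (φ u))) → l′ d ≡ suc (label A u)
      l1 u (yes (v , eq)) = cong (suc ∘ label A) (inj eq)
      l1 u (no ¬p) = ⊥-elim (¬p (u , refl))
      e1 : ∀ u v (d : Dec (Pre (φ u))) (d′ : Dec (Pre (φ v))) → e′ d d′ ≡ adj (graph A) u v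
      e1 u v (yes (_ , p)) (yes (_ , q)) = cong₂ (adj (graph A)) (inj p) (inj q)
      e1 u v (no ¬p) _ = ⊥-elim (¬p (u , refl))
      e1 u v (yes _) (no ¬p) = ⊥-elim (¬p (v , refl))
      l2 : ∀ {x} (d : Dec (Pre x)) → l′ d ≢ zero → Pre x
      l2 (yes p) _ = p
      l2 (no _) h = ⊥-elim (h refl)

    On : Fin N → Fin n → Fin n → Set → Set
    On a x y P = lab a x ≢ zero → lab a y ≢ zero → P

    IsVertex : Fin n → Fin k → Fin N → Set
    IsVertex x l s = lab s x ≡ suc l × (∀ y → y ≢ x → lab s y ≡ zero) × edg s x x ≡ false

    IsUnion : Fin N → Fin N → Fin N → Set
    IsUnion a b s =
      (∀ x → (lab a x ≡ zero × lab s x ≡ lab b x) ⊎ (lab b x ≡ zero × lab s x ≡ lab a x)) ×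
      (∀ x y → (On a x y (edg s x y ≡ edg a x y) × On b x y (edg s x y ≡ edg b x y))
             × (lab a x ≢ zero → lab b y ≢ zero → edg s x y ≡ false × edg s y x ≡ false))

    btw : Fin k → Fin k → Fin (suc k) → Fin (suc k) → Bool
    btw i j a b = (does (a ≟ suc i) ∧ does (b ≟ suc j)) ∨ (does (a ≟ suc j) ∧ does (b ≟ suc i))

    IsJoin : Fin k → Fin k → Fin N → Fin N → Set
    IsJoin i j a s = (∀ x → lab s x ≡ lab a x) ×
      (∀ x y → On a x y (edg s x y ≡ edg a x y ∨ btw i j (lab a x) (lab a y)))

    rl : Fin k → Fin k → Fin (suc k) → Fin (suc k)
    rl i j zero = zero
    rl i j (suc l) = suc (if does (l ≟ i) then j else l)

    IsRelabel : Fin k → Fin k → Fin N → Fin N → Set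
    IsRelabel i j a s = (∀ x → lab s x ≡ rl i j (lab a x)) ×
      (∀ x y → On a x y (edg s x y ≡ edg a x y))

    Step : Subset N → Fin N → Set
    Step p s = (∃[ x ] ∃[ l ] IsVertex x l s)
             ⊎ (∃[ a ] ∃[ b ] ((a ∈ p × b ∈ p) × IsUnion a b s))
             ⊎ (∃[ a ] ∃[ i ] ∃[ j ] (((a ∈ p) × (i ≢ j)) × IsJoin i j a s))
             ⊎ (∃[ a ] ∃[ i ] ∃[ j ] ((a ∈ p) × IsRelabel i j a s))

    nz? : ∀ a x → Dec (lab a x ≢ zero)
    nz? a x = ¬? (lab a x ≟ zero)

    on? : ∀ a x y {P} → Dec P → Dec (On a x y P)
    on? a x y d = nz? a x →-dec (nz? a y →-dec d)

    step? : ∀ p s → Dec (Step p s)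
    step? p s =
      any? (λ x → any? λ l → (lab s x ≟ suc l) ×-dec (all? (λ y → ¬? (y ≟ x) →-dec (lab s y ≟ zero))
          ×-dec (edg s x x Bool.≟ false)))
      ⊎-dec any? (λ a → any? λ b → ((a ∈? p) ×-dec (b ∈? p)) ×-dec
         (all? (λ x → ((lab a x ≟ zero) ×-dec (lab s x ≟ lab b x)) ⊎-dec ((lab b x ≟ zero) ×-dec (lab s x ≟ lab a x)))
         ×-dec all? λ x → all? λ y →
           (on? a x y (edg s x y Bool.≟ edg a x y) ×-dec on? b x y (edg s x y Bool.≟ edg b x y))
           ×-dec (nz? a x →-dec (nz? b y →-dec ((edg s x y Bool.≟ false) ×-dec (edg s y x Bool.≟ false))))))
      ⊎-dec any? (λ a → any? λ i → any? λ j → ((a ∈? p) ×-dec ¬? (i ≟ j)) ×-dec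
         (all? (λ x → lab s x ≟ lab a x) ×-dec all? λ x → all? λ y → on? a x y (edg s x y Bool.≟ _)))
      ⊎-dec any? (λ a → any? λ i → any? λ j → (a ∈? p) ×-dec
         (all? (λ x → lab s x ≟ _) ×-dec all? λ x → all? λ y → on? a x y (edg s x y Bool.≟ _)))

    D : Fin N → Set
    D s = Σ[ e ∈ Expr k ] ∃[ φ ] Realizes ⟦ e ⟧ φ s

    sound : ∀ p s → (∀ {a} → a ∈ p → D a) → Step p s → D s
    sound p s pD (inj₁ (x , l , lx , ly , ex)) = vertex l , (λ _ → x) , record
      { inj = λ { {zero} {zero} _ → refl }
      ; labφ = λ _ → lx ; adjφ = λ _ _ → ex
      ; cover = λ y ne → zero , sym (decidable-stable (y ≟ x) (λ y≢x → ne (ly y y≢x))) }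
    sound p s pD (inj₂ (inj₁ (a , b , (a∈ , b∈) , U , E))) with pD a∈ | pD b∈
    ... | e₁ , φ₁ , R₁ | e₂ , φ₂ , R₂ = (e₁ ⊕ e₂) , (λ u → ψ (splitAt m u)) , record
      { inj = λ {u} {v} eq → split-inj u v (ψ-inj (splitAt m u) (splitAt m v) eq)
      ; labφ = λ u → ψ-lab u
      ; adjφ = λ u v → ψ-adj u v
      ; cover = cov }
      where
      m = order (graph ⟦ e₁ ⟧)
      m′ = order (graph ⟦ e₂ ⟧)
      ψ : Fin m ⊎ Fin m′ → Fin n
      ψ (inj₁ u) = φ₁ u
      ψ (inj₂ u) = φ₂ u
      disj : ∀ x → lab a x ≢ zero → lab b x ≢ zero → ⊥
      disj x na nb with U x
      ... | inj₁ (z , _) = na z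
      ... | inj₂ (z , _) = nb z
      sa : ∀ x → lab a x ≢ zero → lab s x ≡ lab a x
      sa x na with U x
      ... | inj₁ (z , _) = ⊥-elim (na z)
      ... | inj₂ (_ , q) = q
      sb : ∀ x → lab b x ≢ zero → lab s x ≡ lab b x
      sb x nb with U x
      ... | inj₁ (_ , q) = q
      ... | inj₂ (z , _) = ⊥-elim (nb z)
      ψ-inj : ∀ u v → ψ u ≡ ψ v → u ≡ v
      ψ-inj (inj₁ u) (inj₁ v) eq = cong inj₁ (inj R₁ eq)
      ψ-inj (inj₂ u) (inj₂ v) eq = cong inj₂ (inj R₂ eq)
      ψ-inj (inj₁ u) (inj₂ v) eq = ⊥-elim (disj (φ₁ u) (nz R₁ u) (subst (λ x → lab b x ≢ zero) (sym eq) (nz R₂ v)))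
      ψ-inj (inj₂ u) (inj₁ v) eq = ⊥-elim (disj (φ₂ u) (subst (λ x → lab a x ≢ zero) (sym eq) (nz R₁ v)) (nz R₂ u))
      split-inj : ∀ (u v : Fin (m + m′)) → splitAt m u ≡ splitAt m v → u ≡ v
      split-inj u v eq = trans (sym (join-splitAt m m′ u))
        (trans (cong (Fin.join m m′) eq) (join-splitAt m m′ v))
      ψ-lab : ∀ u → lab s (ψ (splitAt m u)) ≡ suc (label ⟦ e₁ ⊕ e₂ ⟧ u)
      ψ-lab u with splitAt m u
      ... | inj₁ u = trans (sa _ (nz R₁ u)) (labφ R₁ u)
      ... | inj₂ u = trans (sb _ (nz R₂ u)) (labφ R₂ u)
      ψ-adj : ∀ u v → edg s (ψ (splitAt m u)) (ψ (splitAt m v)) ≡ adj (graph ⟦ e₁ ⊕ e₂ ⟧) u v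
      ψ-adj u v with splitAt m u | splitAt m v
      ... | inj₁ u | inj₁ v = trans (proj₁ (proj₁ (E _ _)) (nz R₁ u) (nz R₁ v)) (adjφ R₁ u v)
      ... | inj₂ u | inj₂ v = trans (proj₂ (proj₁ (E _ _)) (nz R₂ u) (nz R₂ v)) (adjφ R₂ u v)
      ... | inj₁ u | inj₂ v = proj₁ (proj₂ (E _ _) (nz R₁ u) (nz R₂ v))
      ... | inj₂ u | inj₁ v = proj₂ (proj₂ (E _ _) (nz R₁ v) (nz R₂ u))
      cov : ∀ x → lab s x ≢ zero → ∃[ u ] ψ (splitAt m u) ≡ x
      cov x ne with U x
      ... | inj₁ (_ , q) with cover R₂ x (λ z → ne (trans q z))
      ...   | u , eq = m ↑ʳ u , trans (cong ψ (splitAt-↑ʳ m m′ u)) eq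
      cov x ne | inj₂ (_ , q) with cover R₁ x (λ z → ne (trans q z))
      ...   | u , eq = u ↑ˡ m′ , trans (cong ψ (splitAt-↑ˡ m u m′)) eq
    sound p s pD (inj₂ (inj₂ (inj₁ (a , i , j , (a∈ , i≢j) , L , E)))) with pD a∈
    ... | e , φ , R = join i j i≢j e , φ , record
      { inj = inj R
      ; labφ = λ u → trans (L _) (labφ R u)
      ; adjφ = λ u v → trans (E _ _ (nz R u) (nz R v))
          (cong₂ _∨_ (adjφ R u v) (cong₂ (btw i j) (labφ R u) (labφ R v)))
      ; cover = λ x ne → cover R x (λ z → ne (trans (L x) z)) }
    sound p s pD (inj₂ (inj₂ (inj₂ (a , i , j , a∈ , L , E)))) with pD a∈
    ... | e , φ , R = relabel i j e , φ , record
      { inj = inj R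
      ; labφ = λ u → trans (L _) (cong (rl i j) (labφ R u))
      ; adjφ = λ u v → trans (E _ _ (nz R u) (nz R v)) (adjφ R u v)
      ; cover = λ x ne → cover R x (λ z → ne (trans (L x) (cong (rl i j) z))) }

    complete : ∀ p → (∀ s → Step p s → s ∈ p) → ∀ e φ s → Realizes ⟦ e ⟧ φ s → s ∈ p
    complete p cl (vertex l) φ s R = cl s (inj₁ (φ zero , l , labφ R zero ,
      (λ y ne → uncov R y λ { zero eq → ne (sym eq) }) , adjφ R zero zero))
    complete p cl (join i j i≢j e) φ s R with canon ⟦ e ⟧ φ (inj R)
    ... | a , Q = cl s (inj₂ (inj₂ (inj₁ (a , i , j , (complete p cl e φ a Q , i≢j) , L , E))))
      where
      L : ∀ x → lab s x ≡ lab a x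
      L x with any? (λ u → φ u ≟ x)
      ... | yes (u , refl) = trans (labφ R u) (sym (labφ Q u))
      ... | no h = trans (uncov R x (λ u eq → h (u , eq))) (sym (uncov Q x (λ u eq → h (u , eq))))
      E : ∀ x y → On a x y (edg s x y ≡ edg a x y ∨ btw i j (lab a x) (lab a y))
      E x y nx ny with cover Q x nx | cover Q y ny
      ... | u , refl | v , refl = trans (adjφ R u v) (sym
          (cong₂ _∨_ (adjφ Q u v) (cong₂ (btw i j) (labφ Q u) (labφ Q v))))
    complete p cl (relabel i j e) φ s R with canon ⟦ e ⟧ φ (inj R)
    ... | a , Q = cl s (inj₂ (inj₂ (inj₂ (a , i , j , complete p cl e φ a Q , L , E))))
      where
      L : ∀ x → lab s x ≡ rl i j (lab a x)
      L x with any? (λ u → φ u ≟ x)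
      ... | yes (u , refl) = trans (labφ R u) (sym (cong (rl i j) (labφ Q u)))
      ... | no h = trans (uncov R x (λ u eq → h (u , eq))) (sym (cong (rl i j) (uncov Q x (λ u eq → h (u , eq)))))
      E : ∀ x y → On a x y (edg s x y ≡ edg a x y)
      E x y nx ny with cover Q x nx | cover Q y ny
      ... | u , refl | v , refl = trans (adjφ R u v) (sym (adjφ Q u v))
    complete p cl (e₁ ⊕ e₂) φ s R
      with canon ⟦ e₁ ⟧ (λ u → φ (u ↑ˡ order (graph ⟦ e₂ ⟧))) (λ eq → ↑ˡ-injective _ _ _ (inj R eq))
         | canon ⟦ e₂ ⟧ (λ u → φ (order (graph ⟦ e₁ ⟧) ↑ʳ u)) (λ eq → ↑ʳ-injective _ _ _ (inj R eq))
    ... | a , Q₁ | b , Q₂ = cl s (inj₂ (inj₁ (a , b , (complete p cl e₁ _ a Q₁ , complete p cl e₂ _ b Q₂) , U , E)))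
      where
      m = order (graph ⟦ e₁ ⟧)
      m′ = order (graph ⟦ e₂ ⟧)
      φ₁ = λ (u : Fin m) → φ (u ↑ˡ m′)
      φ₂ = λ (u : Fin m′) → φ (m ↑ʳ u)
      apart : ∀ u v → φ₁ u ≢ φ₂ v
      apart u v eq with trans (sym (splitAt-↑ˡ m u m′)) (trans (cong (splitAt m) (inj R eq)) (splitAt-↑ʳ m m′ v))
      ... | ()
      lab₁ : ∀ u → lab s (φ₁ u) ≡ suc (label ⟦ e₁ ⟧ u)
      lab₁ u with splitAt m (u ↑ˡ m′) | splitAt-↑ˡ m u m′ | labφ R (u ↑ˡ m′)
      ... | _ | refl | q = q
      lab₂ : ∀ u → lab s (φ₂ u) ≡ suc (label ⟦ e₂ ⟧ u)
      lab₂ u with splitAt m (m ↑ʳ u) | splitAt-↑ʳ m m′ u | labφ R (m ↑ʳ u)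
      ... | _ | refl | q = q
      U : ∀ x → (lab a x ≡ zero × lab s x ≡ lab b x) ⊎ (lab b x ≡ zero × lab s x ≡ lab a x)
      U x with any? (λ u → φ₁ u ≟ x) | any? (λ u → φ₂ u ≟ x)
      ... | yes (u , refl) | _ = inj₂ (uncov Q₂ x (λ v eq → apart u v (sym eq)) , trans (lab₁ u) (sym (labφ Q₁ u)))
      ... | no h | yes (u , refl) = inj₁ (uncov Q₁ x (λ v eq → h (v , eq)) , trans (lab₂ u) (sym (labφ Q₂ u)))
      ... | no h | no h′ = inj₁ (uncov Q₁ x (λ v eq → h (v , eq)) ,
          trans (uncov R x nope) (sym (uncov Q₂ x (λ v eq → h′ (v , eq)))))
        where
        nope : ∀ u → φ u ≢ x
        nope u eq with splitAt m u in q
        ... | inj₁ v = h (v , trans (cong φ (splitAt⁻¹-↑ˡ q)) eq)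
        ... | inj₂ v = h′ (v , trans (cong φ (splitAt⁻¹-↑ʳ q)) eq)
      E : ∀ x y → (On a x y (edg s x y ≡ edg a x y) × On b x y (edg s x y ≡ edg b x y))
             × (lab a x ≢ zero → lab b y ≢ zero → edg s x y ≡ false × edg s y x ≡ false)
      E x y = (ea , eb) , ec
        where
        ea : On a x y (edg s x y ≡ edg a x y)
        ea nx ny with cover Q₁ x nx | cover Q₁ y ny
        ... | u , refl | v , refl with splitAt m (u ↑ˡ m′) | splitAt-↑ˡ m u m′ | splitAt m (v ↑ˡ m′) | splitAt-↑ˡ m v m′ | adjφ R (u ↑ˡ m′) (v ↑ˡ m′)
        ...   | _ | refl | _ | refl | q = trans q (sym (adjφ Q₁ u v))
        eb : On b x y (edg s x y ≡ edg b x y)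
        eb nx ny with cover Q₂ x nx | cover Q₂ y ny
        ... | u , refl | v , refl with splitAt m (m ↑ʳ u) | splitAt-↑ʳ m m′ u | splitAt m (m ↑ʳ v) | splitAt-↑ʳ m m′ v | adjφ R (m ↑ʳ u) (m ↑ʳ v)
        ...   | _ | refl | _ | refl | q = trans q (sym (adjφ Q₂ u v))
        ec : lab a x ≢ zero → lab b y ≢ zero → edg s x y ≡ false × edg s y x ≡ false
        ec nx ny with cover Q₁ x nx | cover Q₂ y ny
        ... | u , refl | v , refl with splitAt m (u ↑ˡ m′) | splitAt-↑ˡ m u m′ | splitAt m (m ↑ʳ v) | splitAt-↑ʳ m m′ v | adjφ R (u ↑ˡ m′) (m ↑ʳ v) | adjφ R (m ↑ʳ v) (u ↑ˡ m′)
        ...   | _ | refl | _ | refl | q | q′ = q , q′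

buildable? : ∀ k G → Dec (BuildableWith k G)
buildable? k G with closure (D k n) (Step k n) (step? k n) (sound k n)
  where n = order G
... | p , pD , cl = map′ from to
    (any? λ s → (s ∈? p) ×-dec (all? (λ x → ¬? (lab k n s x ≟ zero)) ×-dec
      all? λ x → all? λ y → edg k n s x y Bool.≟ adj G x y))
  where
  n = order G
  Fits : Fin (N k n) → Set
  Fits s = s ∈ p × (∀ x → lab k n s x ≢ zero) × (∀ x y → edg k n s x y ≡ adj G x y)
  open Realizes
  from : ∃ Fits → BuildableWith k G
  from (s , s∈ , full , ed) with pD s∈
  ... | e , φ , R = e , mk↔ₛ′ φ (λ x → proj₁ (cover R x (full x)))
        (λ x → proj₂ (cover R x (full x))) (λ u → inj R (proj₂ (cover R (φ u) (full (φ u))))) ,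
        λ u v → trans (sym (ed _ _)) (adjφ R u v)
  to : BuildableWith k G → ∃ Fits
  to (e , f , h) with canon k n ⟦ e ⟧ (Inverse.to f) (Injection.injective (Inverse⇒Injection f))
  ... | s , R = s , complete k n p cl e _ s R ,
      (λ x eq → nz k n R (Inverse.from f x) (trans (cong (lab k n s) (Inverse.strictlyInverseˡ f x)) eq)) ,
      λ x y → trans (cong₂ (edg k n s) (sym (Inverse.strictlyInverseˡ f x)) (sym (Inverse.strictlyInverseˡ f y)))
        (trans (adjφ R _ _) (trans (sym (h _ _)) (cong₂ (adj G) (Inverse.strictlyInverseˡ f x) (Inverse.strictlyInverseˡ f y))))

cliqueWidth-exists : ∀ {c G} → BuildableWith c G → ∃[ k ] (IsCliqueWidth G k × k ≤ c)
cliqueWidth-exists {c} {G} B = go c (ℕ.≤-refl) B (search c)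
  where
  search : ∀ m → (∃[ k ] (IsCliqueWidth G k × k < m)) ⊎ (∀ j → j < m → ¬ BuildableWith j G)
  search zero = inj₂ (λ j ())
  search (suc m) with search m
  ... | inj₁ (k , I , lt) = inj₁ (k , I , ℕ.m<n⇒m<1+n lt)
  ... | inj₂ none with buildable? m G
  ...   | yes b = inj₁ (m , (b , λ j bj → ℕ.≮⇒≥ (λ lt → none j lt bj)) , ℕ.≤-refl)
  ...   | no ¬b = inj₂ λ j lt bj → [ (λ l → none j l bj) , (λ { refl → ¬b bj }) ] (ℕ.m≤n⇒m<n∨m≡n (ℕ.≤-pred lt))
  go : ∀ m → m ≤ c → BuildableWith m G → (∃[ k ] (IsCliqueWidth G k × k < m)) ⊎ (∀ j → j < m → ¬ BuildableWith j G) → _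
  go m le b (inj₁ (k , I , lt)) = k , I , ℕ.≤-trans (ℕ.<⇒≤ lt) le
  go m le b (inj₂ none) = m , (b , λ j bj → ℕ.≮⇒≥ (λ lt → none j lt bj)) , le

{-# OPTIONS --safe #-}

-- Fix an induced C₇ in G. The trace of a vertex is its closed neighbourhood on
-- this C₇; 22 of the 128 subsets can occur as traces. For any two of them, s and t,
-- the vertices with trace s are either all equal or adjacent to those with trace
-- t, or all distinct from and non-adjacent to them, because one of the two
-- possibilities already produces 4K₁, C₄ or C₆ on the C₇ and two further
-- vertices. So adjacency is a function of the traces, and G is built vertex by
-- vertex with one label per trace and one more label for the newest vertex.
module Submission where

open import Defs
open import Data.Bool using (Bool; true; false; _∧_; _∨_)
import Data.Bool.Properties as Bool
open import Data.Empty using (⊥-elim)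
open import Data.Fin using (Fin; zero; suc; toℕ; _≟_)
open import Data.Fin.Properties using (all?; suc-injective)
open import Data.List using
  (List; _∷_; []; _++_; concatMap; filter; length; allFin; lookup; cartesianProductWith)
open import Data.List.Membership.DecPropositional using (_∈?_)
open import Data.List.Membership.Propositional using (_∈_)
open import Data.List.Membership.Propositional.Properties using
  (∈-filter⁺; ∈-filter⁻; ∈-allFin; ∈-cartesianProductWith⁺)
import Data.List.Relation.Unary.All as All
open All using (All; _∷_; [])
import Data.List.Relation.Unary.Any as Any
open Any using (Any; here; there; index)
open import Data.List.Relation.Unary.Any.Properties using (lookup-index)
open import Data.Nat using (ℕ; zero; suc; _+_; _≤_)
open import Data.Nat.DivMod using (_mod_)
open import Data.Product using (Σ-syntax; ∃-syntax; _×_; _,_; proj₁; proj₂)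
open import Data.Sum using (_⊎_; inj₁; inj₂)
open import Data.Vec using (Vec; _∷_; []; tabulate)
import Data.Vec as Vec
open import Data.Vec.Functional using () renaming (_∷_ to _◂_)
open import Data.Vec.Properties using (lookup∘tabulate)
open import Function using (_↔_; mk↔ₛ′; module Inverse; _∘_; mk⇔)
open import Function.Properties.Inverse using (↔-refl)
open import Relation.Binary using (Decidable)
open import Relation.Binary.PropositionalEquality
  using (_≡_; _≢_; refl; sym; trans; cong; cong₂; subst)
open import Relation.Nullary using (¬_; Dec; yes; no; does; ¬?; _⊎-dec_; _→-dec_)
open import Relation.Nullary.Decidable using
  (from-yes; dec-true; dec-false; does-⇔; map′)

-- Graphs whose adjacency is a function of a vertex colouring

-- Copies the local function of `addEdges`, which cannot be named from outside; both unfold to the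
-- same term.
between : ∀ {k} → Fin k → Fin k → Fin k → Fin k → Bool
between i j a b = (does (a ≟ i) ∧ does (b ≟ j)) ∨ (does (a ≟ j) ∧ does (b ≟ i))

record Realises {k n} (e : Expr k) (edge : Fin n → Fin n → Bool) (lab : Fin n → Fin k) : Set where
  field
    iso        : Vertex (graph ⟦ e ⟧) ↔ Fin n
    adj-iso    : ∀ u v → edge (Inverse.to iso u) (Inverse.to iso v) ≡ adj (graph ⟦ e ⟧) u v
    label-iso  : ∀ u → label ⟦ e ⟧ u ≡ lab (Inverse.to iso u)

open Realises

Realisable : ∀ {k n} → (Fin n → Fin n → Bool) → (Fin n → Fin k) → Set
Realisable {k} edge lab = Σ[ e ∈ Expr k ] Realises e edge lab

module _ {k : ℕ} where

  realisable-resp : ∀ {n} {a b : Fin n → Fin n → Bool} {l l′ : Fin n → Fin k} →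
    (∀ x y → b x y ≡ a x y) → (∀ x → l x ≡ l′ x) → Realisable a l → Realisable b l′
  realisable-resp b≡a l≡l′ (e , r) = e , record
    { iso       = iso r
    ; adj-iso   = λ u v → trans (b≡a _ _) (adj-iso r u v)
    ; label-iso = λ u → trans (label-iso r u) (l≡l′ _)
    }

  realisable-vertex : (l : Fin 1 → Fin k) → Realisable (λ _ _ → false) l
  realisable-vertex l = vertex (l zero) , record
    { iso       = ↔-refl
    ; adj-iso   = λ _ _ → refl
    ; label-iso = λ { zero → refl }
    }

  realisable-join : ∀ {n} {a : Fin n → Fin n → Bool} {l : Fin n → Fin k} {i j} → i ≢ j →
    Realisable a l → Realisable (λ x y → a x y ∨ between i j (l x) (l y)) l
  realisable-join {i = i} {j} i≢j (e , r) = join i j i≢j e , record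
    { iso       = iso r
    ; adj-iso   = λ u v → cong₂ _∨_ (adj-iso r u v)
                    (sym (cong₂ (between i j) (label-iso r u) (label-iso r v)))
    ; label-iso = label-iso r
    }

  realisable-relabel : ∀ {n} {a : Fin n → Fin n → Bool} {l l′ : Fin n → Fin k} (i j : Fin k) →
    (∀ x → l x ≡ i → l′ x ≡ j) → (∀ x → l x ≢ i → l′ x ≡ l x) →
    Realisable a l → Realisable a l′
  realisable-relabel {l = l} {l′} i j at away (e , r) = relabel i j e , record
    { iso       = iso r
    ; adj-iso   = adj-iso r
    ; label-iso = relabelled
    }
    where
    relabelled : ∀ u → label ⟦ relabel i j e ⟧ u ≡ l′ (Inverse.to (iso r) u)
    relabelled u with label ⟦ e ⟧ u | label-iso r u
    ... | m | eq with m ≟ i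
    ...   | yes m≡i = sym (at _ (trans (sym eq) m≡i))
    ...   | no  m≢i = trans eq (sym (away _ (m≢i ∘ trans eq)))

cone : ∀ {n} → (Fin n → Fin n → Bool) → (Fin n → Bool) → Fin (suc n) → Fin (suc n) → Bool
cone a c zero    zero    = false
cone a c zero    (suc y) = c y
cone a c (suc x) zero    = c x
cone a c (suc x) (suc y) = a x y

-- With the single vertex on the left of `⊕`, `splitAt 1` reduces on `zero` and on `suc u`, so the
-- adjacency cases need no lemma about `splitAt`.
realisable-isolated : ∀ {k n} {a : Fin n → Fin n → Bool} {l : Fin n → Fin k} (i : Fin k) →
  Realisable a l → Realisable (cone a (λ _ → false)) (i ◂ l)
realisable-isolated {a = a} {l} i (e , r) = vertex i ⊕ e , record
  { iso       = mk↔ₛ′ to⁺ from⁺ to-from from-to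
  ; adj-iso   = adj⁺
  ; label-iso = λ { zero → refl ; (suc u) → label-iso r u }
  }
  where
  open Inverse (iso r)
  to⁺ : Vertex (graph ⟦ vertex i ⊕ e ⟧) → Fin _
  to⁺ zero    = zero
  to⁺ (suc u) = suc (to u)
  from⁺ : Fin _ → Vertex (graph ⟦ vertex i ⊕ e ⟧)
  from⁺ zero    = zero
  from⁺ (suc x) = suc (from x)
  to-from : ∀ x → to⁺ (from⁺ x) ≡ x
  to-from zero    = refl
  to-from (suc x) = cong suc (strictlyInverseˡ x)
  from-to : ∀ u → from⁺ (to⁺ u) ≡ u
  from-to zero    = refl
  from-to (suc u) = cong suc (strictlyInverseʳ u)
  adj⁺ : ∀ u v → cone a (λ _ → false) (to⁺ u) (to⁺ v) ≡ adj (graph ⟦ vertex i ⊕ e ⟧) u v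
  adj⁺ zero    zero    = refl
  adj⁺ zero    (suc v) = refl
  adj⁺ (suc u) zero    = refl
  adj⁺ (suc u) (suc v) = adj-iso r u v

module _ {n m : ℕ} {a : Fin n → Fin n → Bool} {κ : Fin n → Fin m} where

  -- One `join` for each colour in `js`. Label `zero` occurs only on the new vertex, so joining it
  -- with `suc j` adds no edge between old vertices.
  realisable-cone : Realisable a (suc ∘ κ) → (js : List (Fin m)) →
    Realisable (cone a (λ y → does (_∈?_ _≟_ (κ y) js))) (zero ◂ suc ∘ κ)
  realisable-cone R []       = realisable-isolated zero R
  realisable-cone R (j ∷ js) =
    realisable-resp joined (λ _ → refl) (realisable-join {i = zero} {suc j} (λ ()) (realisable-cone R js))
    where
    c = λ y → does (_∈?_ _≟_ (κ y) js)
    joined : ∀ x y → cone a (λ y → does (κ y ≟ j) ∨ c y) x y ≡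
             cone a c x y ∨ between zero (suc j) ((zero ◂ suc ∘ κ) x) ((zero ◂ suc ∘ κ) y)
    joined zero    zero    = refl
    joined zero    (suc y) = trans (Bool.∨-comm (does (κ y ≟ j)) (c y))
                               (cong (c y ∨_) (sym (Bool.∨-identityʳ _)))
    joined (suc x) zero    = trans (Bool.∨-comm (does (κ x ≟ j)) (c x))
                               (cong (c x ∨_) (sym (Bool.∧-identityʳ _)))
    joined (suc x) (suc y) = sym (trans (cong (a x y ∨_) (Bool.∧-zeroʳ _)) (Bool.∨-identityʳ _))

module _ {m : ℕ} {A : Fin m → Fin m → Set} (A? : Decidable A) where

  -- Induction on `n`. Vertex `zero` enters with the spare label `zero`, is joined to the colours
  -- that `A` relates to its own, and then takes the label of its colour, which frees the spare
  -- label for the next vertex.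
  coloured-realisable : ∀ n (edge : Fin (suc n) → Fin (suc n) → Bool) (κ : Fin (suc n) → Fin m) →
    (∀ x y → edge x y ≡ edge y x) → (∀ x → edge x x ≡ false) →
    (∀ x y → x ≢ y → edge x y ≡ does (A? (κ x) (κ y))) →
    Realisable {suc m} edge (suc ∘ κ)
  -- The induction starts at one vertex because no expression builds the empty graph.
  coloured-realisable zero edge κ edge-sym edge-irrefl edge≡A =
    realisable-resp (λ { zero zero → edge-irrefl zero }) (λ _ → refl) (realisable-vertex (suc ∘ κ))
  coloured-realisable (suc n) edge κ edge-sym edge-irrefl edge≡A =
    realisable-relabel zero (suc (κ zero))
      (λ { zero _ → refl ; (suc x) () }) (λ { zero ≢0 → ⊥-elim (≢0 refl) ; (suc x) _ → refl })
      (realisable-resp coned (λ _ → refl)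
        (realisable-cone
          (coloured-realisable n (λ x y → edge (suc x) (suc y)) (κ ∘ suc)
            (λ x y → edge-sym _ _) (λ x → edge-irrefl _)
            (λ x y x≢y → edge≡A _ _ (x≢y ∘ suc-injective)))
          targets))
    where
    targets = filter (A? (κ zero)) (allFin m)
    c = λ y → does (_∈?_ _≟_ (κ (suc y)) targets)
    edge₀ : ∀ y → edge zero (suc y) ≡ c y
    edge₀ y = trans (edge≡A zero (suc y) (λ ()))
      (does-⇔ (mk⇔ (∈-filter⁺ (A? (κ zero)) (∈-allFin _)) (proj₂ ∘ ∈-filter⁻ (A? (κ zero)) {xs = allFin m}))
        (A? (κ zero) (κ (suc y))) (_∈?_ _≟_ (κ (suc y)) targets))
    coned : ∀ x y → edge x y ≡ cone (λ x y → edge (suc x) (suc y)) c x y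
    coned zero    zero    = edge-irrefl zero
    coned zero    (suc y) = edge₀ y
    coned (suc x) zero    = trans (edge-sym (suc x) zero) (edge₀ x)
    coned (suc x) (suc y) = refl

  coloured-buildable : (G : Graph) → Vertex G → (κ : Vertex G → Fin m) →
    (∀ u v → u ≢ v → adj G u v ≡ does (A? (κ u) (κ v))) → BuildableWith (suc m) G
  coloured-buildable record { order = suc n ; adj = edge ; adj-sym = s ; adj-irrefl = i } _ κ adj≡A
    with e , r ← coloured-realisable n edge κ s i adj≡A = e , iso r , adj-iso r

-- Induced subgraphs and closed neighbourhoods

-- Counting equality as adjacency lets one bit describe a pair of vertices that may coincide, such
-- as an arbitrary vertex and one on the cycle.
closed : (G : Graph) → Vertex G → Vertex G → Bool
closed G u v = does (u ≟ v) ∨ adj G u v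

TwinFree : Graph → Set
TwinFree H = ∀ a b → (∀ c → closed H a c ≡ closed H b c) → a ≡ b

closed-refl : ∀ G v → closed G v v ≡ true
closed-refl G v = cong (_∨ adj G v v) (dec-true (v ≟ v) refl)

closed-≢ : ∀ G {u v} → u ≢ v → closed G u v ≡ adj G u v
closed-≢ G {u} {v} u≢v = cong (_∨ adj G u v) (dec-false (u ≟ v) u≢v)

closed-sym : ∀ G u v → closed G u v ≡ closed G v u
closed-sym G u v = cong₂ _∨_ (does-⇔ (mk⇔ sym sym) (u ≟ v) (v ≟ u)) (adj-sym G u v)

-- In a twin-free H the closed neighbourhoods separate the vertices, so a map
-- preserving them is automatically injective.
closed-embedding : ∀ {H G} → TwinFree H → (f : Vertex H → Vertex G) →
  (∀ a b → closed G (f a) (f b) ≡ closed H a b) → H ⊑ G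
closed-embedding {H} {G} twinFree f f-closed = f , f-inj , f-adj
  where
  f-inj : ∀ {a b} → f a ≡ f b → a ≡ b
  f-inj {a} {b} eq = twinFree a b λ c →
    trans (sym (f-closed a c)) (trans (cong (λ x → closed G x (f c)) eq) (f-closed b c))
  f-adj : ∀ a b → adj G (f a) (f b) ≡ adj H a b
  f-adj a b with a ≟ b
  ... | yes refl = trans (adj-irrefl G (f a)) (sym (adj-irrefl H a))
  ... | no  a≢b  = trans (sym (closed-≢ G (a≢b ∘ f-inj))) (trans (f-closed a b) (closed-≢ H a≢b))

⊑-closed : ∀ {H G} ((f , _) : H ⊑ G) → ∀ a b → closed G (f a) (f b) ≡ closed H a b
⊑-closed (f , f-inj , f-adj) a b =
  cong₂ _∨_ (does-⇔ (mk⇔ f-inj (cong f)) (f a ≟ f b) (a ≟ b)) (f-adj a b)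

twinFree? : ∀ H → Dec (TwinFree H)
twinFree? H = map′ (λ h a b → h a b) (λ h a b → h a b)
  (all? λ a → all? λ b → all? (λ c → closed H a c Bool.≟ closed H b c) →-dec (a ≟ b))

-- Two vertices together with an induced C₇

data Point : Set where
  rim        : Fin 7 → Point
  left right : Point

Trace : Set
Trace = Vec Bool 7

-- The bit `b` says whether `left` and `right` are equal or adjacent. Together with the two traces
-- it fixes all closed adjacencies, which makes the search for obstructions finite.
pairModel : Trace → Trace → Bool → Point → Point → Bool
pairModel s t b (rim i) (rim j) = closed (C 7) i j
pairModel s t b (rim i) left    = Vec.lookup s i
pairModel s t b (rim i) right   = Vec.lookup t i
pairModel s t b left    (rim j) = Vec.lookup s j
pairModel s t b left    left    = true
pairModel s t b left    right   = b
pairModel s t b right   (rim j) = Vec.lookup t j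
pairModel s t b right   left    = b
pairModel s t b right   right   = true

Matches : (H : Graph) → (Point → Point → Bool) → Vec Point (order H) → Set
Matches H M ps = ∀ a b → M (Vec.lookup ps a) (Vec.lookup ps b) ≡ closed H a b

-- Rotations suffice: the mirror image of each shape below is a rotation of a shape in the same
-- list, with the two further points exchanged where necessary.
rotations : ∀ {k} → (Point → Point → (ℕ → Point) → List (Vec Point k)) → List (Vec Point k)
rotations shapes = concatMap
  (λ i → let r = λ d → rim ((toℕ i + d) mod 7) in shapes left right r ++ shapes right left r)
  (allFin 7)

-- x and y are the two further points in either order, r 0, r 1, … consecutive
-- vertices of the C₇; these placements exclude every
-- configuration that does not occur.
places4K₁ placesC₄ : List (Vec Point 4)
places4K₁ = rotations λ x y r →
  (x ∷ r 0 ∷ r 2 ∷ r 4 ∷ []) ∷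
  (x ∷ y ∷ r 0 ∷ r 2 ∷ []) ∷
  (x ∷ y ∷ r 0 ∷ r 3 ∷ []) ∷ []

placesC₄ = rotations λ x y r →
  (x ∷ r 0 ∷ r 1 ∷ r 2 ∷ []) ∷
  (x ∷ y ∷ r 0 ∷ r 1 ∷ []) ∷
  (x ∷ r 0 ∷ y ∷ r 2 ∷ []) ∷
  (x ∷ r 0 ∷ y ∷ r 3 ∷ []) ∷ []

placesC₆ : List (Vec Point 6)
placesC₆ = rotations λ x y r →
  (x ∷ r 0 ∷ r 1 ∷ r 2 ∷ r 3 ∷ r 4 ∷ []) ∷
  (x ∷ y ∷ r 0 ∷ r 1 ∷ r 2 ∷ r 3 ∷ []) ∷
  (x ∷ r 0 ∷ r 1 ∷ r 2 ∷ y ∷ r 4 ∷ []) ∷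
  (x ∷ r 0 ∷ r 1 ∷ r 2 ∷ y ∷ r 5 ∷ []) ∷ []

Obstructed : (Point → Point → Bool) → Set
Obstructed M = Any (Matches 4K₁ M) places4K₁
             ⊎ Any (Matches (C 4) M) placesC₄
             ⊎ Any (Matches (C 6) M) placesC₆

matches? : ∀ H M ps → Dec (Matches H M ps)
matches? H M ps = all? λ a → all? λ b → M (Vec.lookup ps a) (Vec.lookup ps b) Bool.≟ closed H a b

boolVecs : ∀ n → List (Vec Bool n)
boolVecs zero    = [] ∷ []
boolVecs (suc n) = cartesianProductWith _∷_ (true ∷ false ∷ []) (boolVecs n)

∈-boolVecs : ∀ {n} (v : Vec Bool n) → v ∈ boolVecs n
∈-boolVecs []      = here refl
∈-boolVecs (b ∷ v) = ∈-cartesianProductWith⁺ _∷_ (∈-bools b) (∈-boolVecs v)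
  where
  ∈-bools : ∀ b → b ∈ true ∷ false ∷ []
  ∈-bools true  = here refl
  ∈-bools false = there (here refl)

-- The two further points of the model may coincide, so a single vertex is the
-- case left = right.
Admissible : Trace → Set
Admissible s = ¬ Obstructed (pairModel s s true)

Determined : Trace → Trace → Set
Determined s t = Obstructed (pairModel s t false) ⊎ Obstructed (pairModel s t true)

abstract

  -- Abstract, so that the search is evaluated for `determined` and stays folded wherever `traces`
  -- occurs in a type.
  obstructed? : ∀ M → Dec (Obstructed M)
  obstructed? M = Any.any? (matches? 4K₁ M) places4K₁
            ⊎-dec Any.any? (matches? (C 4) M) placesC₄
            ⊎-dec Any.any? (matches? (C 6) M) placesC₆

  admissible? : ∀ s → Dec (Admissible s)
  admissible? s = ¬? (obstructed? (pairModel s s true))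

  traces : List Trace
  traces = filter admissible? (boolVecs 7)

  ∈-traces : ∀ s → Admissible s → s ∈ traces
  ∈-traces s = ∈-filter⁺ admissible? (∈-boolVecs s)

  -- A finite computation: the decision procedure is run on every pair from `traces`.
  determined : All (λ s → All (Determined s) traces) traces
  determined = from-yes (All.all? (λ s → All.all? (λ t →
    obstructed? (pairModel s t false) ⊎-dec obstructed? (pairModel s t true)) traces) traces)

-- Graphs containing an induced C₇

module _ (G : Graph) (free : (4K₁ ∷ C 4 ∷ C 6 ∷ []) -free G) (cycle : C 7 ⊑ G) where

  private
    v = proj₁ cycle

  trace : Vertex G → Trace
  trace u = tabulate (λ i → closed G u (v i))

  lookup-trace : ∀ u i → closed G u (v i) ≡ Vec.lookup (trace u) i
  lookup-trace u i = sym (lookup∘tabulate (λ i → closed G u (v i)) i)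

  place : Vertex G → Vertex G → Point → Vertex G
  place u w (rim i) = v i
  place u w left    = u
  place u w right   = w

  place-pairModel : ∀ u w p q →
    closed G (place u w p) (place u w q) ≡ pairModel (trace u) (trace w) (closed G u w) p q
  place-pairModel u w (rim i) (rim j) = ⊑-closed {C 7} {G} cycle i j
  place-pairModel u w (rim i) left    = trans (closed-sym G (v i) u) (lookup-trace u i)
  place-pairModel u w (rim i) right   = trans (closed-sym G (v i) w) (lookup-trace w i)
  place-pairModel u w left    (rim j) = lookup-trace u j
  place-pairModel u w left    left    = closed-refl G u
  place-pairModel u w left    right   = refl
  place-pairModel u w right   (rim j) = lookup-trace w j
  place-pairModel u w right   left    = closed-sym G w u
  place-pairModel u w right   right   = closed-refl G w

  -- `place` may identify points, when `u` equals `w` or lies on the cycle. A match still yields an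
  -- induced subgraph because the three forbidden graphs are twin-free.
  unobstructed : ∀ u w → ¬ Obstructed (pairModel (trace u) (trace w) (closed G u w))
  unobstructed u w = excluded free
    where
    embeds : ∀ H → TwinFree H → ∀ {ps} →
      Any (Matches H (pairModel (trace u) (trace w) (closed G u w))) ps → H ⊑ G
    embeds H twinFree match with ps , matches ← Any.satisfied match =
      closed-embedding {H} {G} twinFree (place u w ∘ Vec.lookup ps)
        (λ a b → trans (place-pairModel u w (Vec.lookup ps a) (Vec.lookup ps b)) (matches a b))
    excluded : (4K₁ ∷ C 4 ∷ C 6 ∷ []) -free G →
      ¬ Obstructed (pairModel (trace u) (trace w) (closed G u w))
    excluded (no4K₁ ∷ _ ∷ _ ∷ []) (inj₁ match)        = no4K₁ (embeds 4K₁ (from-yes (twinFree? 4K₁)) match)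
    excluded (_ ∷ noC₄ ∷ _ ∷ []) (inj₂ (inj₁ match))  = noC₄ (embeds (C 4) (from-yes (twinFree? (C 4))) match)
    excluded (_ ∷ _ ∷ noC₆ ∷ []) (inj₂ (inj₂ match))  = noC₆ (embeds (C 6) (from-yes (twinFree? (C 6))) match)

  trace∈traces : ∀ u → trace u ∈ traces
  trace∈traces u = ∈-traces (trace u)
    (subst (λ b → ¬ Obstructed (pairModel (trace u) (trace u) b)) (closed-refl G u) (unobstructed u u))

  colour : Vertex G → Fin (length traces)
  colour u = index (trace∈traces u)

  -- An obstruction at `false` forces the bit to be `true`; being a condition on traces alone, this
  -- can serve as the relation between colours.
  Linked : Trace → Trace → Set
  Linked s t = Obstructed (pairModel s t false)

  linked? : ∀ s t → Dec (Linked s t)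
  linked? s t = obstructed? (pairModel s t false)

  closed-linked : ∀ u w → closed G u w ≡ does (linked? (trace u) (trace w))
  closed-linked u w = by-cases (closed G u w) (unobstructed u w)
    (All.lookup (All.lookup determined (trace∈traces u)) (trace∈traces w))
    where
    by-cases : ∀ b {s t} → ¬ Obstructed (pairModel s t b) → Determined s t → b ≡ does (linked? s t)
    by-cases false {s} {t} free′ _        = sym (dec-false (linked? s t) free′)
    -- For the bit `true`, `determined` must yield an obstruction at `false`, since one at `true`
    -- would occur in `G`.
    by-cases true  {s} {t} _     (inj₁ o) = sym (dec-true (linked? s t) o)
    by-cases true          free′ (inj₂ o) = ⊥-elim (free′ o)

  buildable : BuildableWith (suc (length traces)) G
  -- `v zero` witnesses that `G` is nonempty.
  buildable = coloured-buildable (λ i j → linked? (lookup traces i) (lookup traces j)) G (v zero) colour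
    λ u w u≢w → trans (sym (closed-≢ G u≢w)) (trans (closed-linked u w)
      (cong₂ (λ s t → does (linked? s t)) (lookup-index (trace∈traces u)) (lookup-index (trace∈traces w))))

theorem2p3 : ∃[ c ] ((G : Graph) → (4K₁ ∷ C 4 ∷ C 6 ∷ []) -free G → C 7 ⊑ G →
    ∃[ k ] (IsCliqueWidth G k × k ≤ c))
-- `traces` is computed without reference to `G`, so the bound is uniform.
theorem2p3 = suc (length traces) , λ G free cycle → cliqueWidth-exists {G = G} (buildable G free cycle)
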